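{- Let $G$ be a semi-perfect graph and let $k$ be a positive integer. The following statements are equivalent: (a) $G$ has a $k$-tight clique partition; (b) $G$ has a $k$-tight $\alpha$-clique partition; (c) every $\alpha$-clique partition of $G$ is $k$-tight; (d) $\mu_\alpha(G)\le k-1$.
   Context: All graphs are finite, simple and undirected. For a graph $G$, $\alpha(G)$ is the maximum size of an independent set and $i(G)$ is the minimum size of a maximal (with respect to inclusion) independent set; the independence gap is $\mu_\alpha(G)=\alpha(G)-i(G)$. $\theta(G)$ denotes the minimum number of cliques whose union is $V(G)$. A graph $G$ is semi-perfect if $\alpha(G)=\theta(G)$. A clique partition of $G$ is a set of pairwise disjoint cliques whose union is $V(G)$; an $\alpha$-clique partition is a clique partition consisting of exactly $\alpha(G)$ cliques. For a positive integer $k$, a clique partition of $G$ is $k$-tight if for every $k$ cliques of the partition, their union intersects every maximal independent set of $G$. -}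

module Defs where

open import Data.Fin using (Fin; zero; suc)
open import Data.Fin.Properties using (all?; any?) renaming (_≟_ to _≟ᶠ_)
open import Data.Fin.Subset using (Subset; _∈_; _⊆_; ∣_∣; ⁅_⁆; ⊥; Nonempty)
open import Data.Fin.Subset.Properties
  using (_∈?_; _⊆?_; anySubset?; ∣p∣≤n; ∉⊥; x∈⁅x⁆; x∈⁅y⁆⇒x≡y; p⊂q⇒∣p∣<∣q∣)
open import Data.Nat using (ℕ; zero; suc; _∸_; _≤_; z≤n; _≟_)
open import Data.Nat.Properties
  using (≤-refl; ≤-reflexive; ≤-trans; ≤-pred; ≤∧≢⇒<; <⇒≱; ≮⇒≥; n≤0⇒n≡0; anyUpTo?)
open import Data.Product using (Σ; ∃; _×_; _,_; proj₁; proj₂)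
open import Data.Vec.Functional using () renaming ([] to []ᶠ; _∷_ to _∷ᶠ_)
open import Function using (_∘_)
open import Level using (0ℓ)
open import Relation.Binary.Core using (Rel)
import Relation.Binary.Definitions as B
open import Relation.Binary.PropositionalEquality using (_≡_; _≢_; _≗_; refl; sym; subst)
open import Relation.Nullary using (Dec; yes; no; ¬_; contradiction; ¬?; _×-dec_; _→-dec_; map′)
open import Relation.Nullary.Decidable using (decidable-stable)
open import Relation.Unary using (Pred; Decidable)

IsLeast : Pred ℕ 0ℓ → Pred ℕ 0ℓ
IsLeast P m = P m × (∀ j → P j → m ≤ j)

IsGreatest : Pred ℕ 0ℓ → Pred ℕ 0ℓ
IsGreatest P m = P m × (∀ j → P j → j ≤ m)

least : {P : Pred ℕ 0ℓ} → Decidable P → ∃ P → ∃ (IsLeast P)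
least {P} P? (b , pb) = go b b ≤-refl pb
  where
  go : ∀ fuel b → b ≤ fuel → P b → ∃ (IsLeast P)
  go zero b b≤0 pb = b , pb , λ j _ → subst (_≤ j) (sym (n≤0⇒n≡0 b≤0)) z≤n
  go (suc fuel) b b≤ pb with anyUpTo? P? b
  ... | yes (j , j<b , pj) = go fuel j (≤-pred (≤-trans j<b b≤)) pj
  ... | no none            = b , pb , λ j pj → ≮⇒≥ λ j<b → none (j , j<b , pj)

greatest : {P : Pred ℕ 0ℓ} → Decidable P → ∀ b → (∀ j → P j → j ≤ b) →
           ∃ P → ∃ (IsGreatest P)
greatest P? zero bound (j , pj) = j , pj , λ i pi → ≤-trans (bound i pi) z≤n
greatest {P} P? (suc b) bound ex with P? (suc b)
... | yes p = suc b , p , bound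
... | no ¬p = greatest P? b bound′ ex
  where
  bound′ : ∀ j → P j → j ≤ b
  bound′ j pj = ≤-pred (≤∧≢⇒< (bound j pj) λ j≡ → ¬p (subst P j≡ pj))

-- Decidability of adjacency makes the graph a finite object constructively,
-- so that its invariants below are honest natural numbers.
record Graph (n : ℕ) : Set₁ where
  infix 4 _~_ _~?_
  field
    _~_    : Rel (Fin n) 0ℓ
    _~?_   : B.Decidable _~_
    ~-sym  : B.Symmetric _~_
    ~-irr  : B.Irreflexive _≡_ _~_

module _ {n : ℕ} (G : Graph n) where
  open Graph G

  Independent : Pred (Subset n) 0ℓ
  Independent S = ∀ u v → u ∈ S → v ∈ S → ¬ (u ~ v)

  MaximalIndependent : Pred (Subset n) 0ℓ
  MaximalIndependent S = Independent S × (∀ T → Independent T → S ⊆ T → T ⊆ S)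

  Clique : Pred (Subset n) 0ℓ
  Clique S = ∀ u v → u ∈ S → v ∈ S → u ≢ v → u ~ v

  Covers : ∀ {m} → Pred (Fin m → Subset n) 0ℓ
  Covers F = ∀ v → ∃ λ j → v ∈ F j

  IndependentOfSize : Pred ℕ 0ℓ
  IndependentOfSize s = ∃ λ S → Independent S × ∣ S ∣ ≡ s

  MaximalIndependentOfSize : Pred ℕ 0ℓ
  MaximalIndependentOfSize s = ∃ λ S → MaximalIndependent S × ∣ S ∣ ≡ s

  -- Repeated or empty members are harmless here: they cannot lower the minimum.
  CliqueCoverOfSize : Pred ℕ 0ℓ
  CliqueCoverOfSize m = ∃ λ (F : Fin m → Subset n) → (∀ j → Clique (F j)) × Covers F

  independent? : Decidable Independent
  independent? S = all? λ u → all? λ v → u ∈? S →-dec (v ∈? S →-dec ¬? (u ~? v))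

  maximalIndependent? : Decidable MaximalIndependent
  maximalIndependent? S = independent? S ×-dec map′ to from (¬? (anySubset? larger?))
    where
    Larger : Pred (Subset n) 0ℓ
    Larger T = Independent T × S ⊆ T × ¬ (T ⊆ S)

    larger? : Decidable Larger
    larger? T = independent? T ×-dec (S ⊆? T ×-dec ¬? (T ⊆? S))

    to : ¬ ∃ Larger → ∀ T → Independent T → S ⊆ T → T ⊆ S
    to none T iT S⊆T = decidable-stable (T ⊆? S) λ T⊈S →
      none (T , iT , (λ {x} → S⊆T {x}) , λ T⊆S → T⊈S T⊆S)

    from : (∀ T → Independent T → S ⊆ T → T ⊆ S) → ¬ ∃ Larger
    from max (T , iT , S⊆T , T⊈S) = T⊈S (max T iT S⊆T)

  clique? : Decidable Clique
  clique? S = all? λ u → all? λ v →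
    u ∈? S →-dec (v ∈? S →-dec (¬? (u ≟ᶠ v) →-dec u ~? v))

  private
    anyFamily? : ∀ {m} {P : Pred (Fin m → Subset n) 0ℓ} →
                 (∀ {F F′} → F ≗ F′ → P F → P F′) → Decidable P → Dec (∃ P)
    anyFamily? {zero} resp P? =
      map′ ([]ᶠ ,_) (λ { (F , p) → resp (λ ()) p }) (P? []ᶠ)
    anyFamily? {suc m} resp P? =
      map′ (λ { (S , F , p) → S ∷ᶠ F , p })
           (λ { (F , p) → F zero , F ∘ suc ,
                  resp (λ { zero → refl ; (suc _) → refl }) p })
           (anySubset? λ S → anyFamily?
             (λ eq → resp λ { zero → refl ; (suc j) → eq j })
             (λ F → P? (S ∷ᶠ F)))

  cliqueCoverOfSize? : Decidable CliqueCoverOfSize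
  cliqueCoverOfSize? m = anyFamily?
    (λ { eq (cl , cov) → (λ j → subst Clique (eq j) (cl j))
                       , (λ v → proj₁ (cov v) , subst (v ∈_) (eq _) (proj₂ (cov v))) })
    (λ F → all? (clique? ∘ F) ×-dec all? λ v → any? λ j → v ∈? F j)

  private
    α-exists : ∃ (IsGreatest IndependentOfSize)
    α-exists = greatest (λ s → anySubset? λ S → independent? S ×-dec ∣ S ∣ ≟ s) n
      (λ { _ (S , _ , refl) → ∣p∣≤n S })
      (∣ ⊥ {n} ∣ , ⊥ , (λ _ _ u∈⊥ → contradiction u∈⊥ ∉⊥) , refl)

  α : ℕ
  α = proj₁ α-exists

  α-spec : IsGreatest IndependentOfSize α
  α-spec = proj₂ α-exists

  private
    maximum⇒maximal : MaximalIndependentOfSize α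
    maximum⇒maximal with proj₁ α-spec
    ... | S , iS , ∣S∣≡α = S , (iS , max) , ∣S∣≡α
      where
      max : ∀ T → Independent T → S ⊆ T → T ⊆ S
      max T iT S⊆T {x} x∈T = decidable-stable (x ∈? S) λ x∉S →
        <⇒≱ (p⊂q⇒∣p∣<∣q∣ ((λ {y} → S⊆T {y}) , x , x∈T , x∉S))
            (≤-trans (proj₂ α-spec _ (T , iT , refl)) (≤-reflexive (sym ∣S∣≡α)))

    i-exists : ∃ (IsLeast MaximalIndependentOfSize)
    i-exists = least (λ s → anySubset? λ S → maximalIndependent? S ×-dec ∣ S ∣ ≟ s)
                     (α , maximum⇒maximal)

    θ-exists : ∃ (IsLeast CliqueCoverOfSize)
    θ-exists = least cliqueCoverOfSize?
      (n , ⁅_⁆ , singletonClique , λ v → v , x∈⁅x⁆ v)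
      where
      singletonClique : ∀ j → Clique ⁅ j ⁆
      singletonClique j u v u∈ v∈ u≢v with x∈⁅y⁆⇒x≡y j u∈ | x∈⁅y⁆⇒x≡y j v∈
      ... | refl | refl = contradiction refl u≢v

  i : ℕ
  i = proj₁ i-exists

  i-spec : IsLeast MaximalIndependentOfSize i
  i-spec = proj₂ i-exists

  θ : ℕ
  θ = proj₁ θ-exists

  θ-spec : IsLeast CliqueCoverOfSize θ
  θ-spec = proj₂ θ-exists

  i≤α : i ≤ α
  i≤α = proj₂ i-spec α maximum⇒maximal

  -- The subtraction never truncates, by i≤α.
  μα : ℕ
  μα = α ∸ i

  SemiPerfect : Set
  SemiPerfect = α ≡ θ

  -- A clique partition with exactly m blocks, enumerated by Fin m; since the
  -- blocks are nonempty and disjoint they are pairwise distinct, so a set of k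
  -- blocks is the same as a k-element subset of Fin m.
  record CliquePartition (m : ℕ) : Set where
    field
      block    : Fin m → Subset n
      nonempty : ∀ j → Nonempty (block j)
      clique   : ∀ j → Clique (block j)
      disjoint : ∀ j l → j ≢ l → ∀ v → v ∈ block j → ¬ (v ∈ block l)
      covers   : Covers block

  αCliquePartition : Set
  αCliquePartition = CliquePartition α

  Tight : ∀ {m} → ℕ → Pred (CliquePartition m) 0ℓ
  Tight {m} k 𝒫 = ∀ (K : Subset m) → ∣ K ∣ ≡ k →
    ∀ I → MaximalIndependent I →
    ∃ λ v → v ∈ I × ∃ λ j → j ∈ K × v ∈ CliquePartition.block 𝒫 j

-- An independent set I meets each clique at most once, so in a partition into m
-- cliques it misses exactly m ∸ ∣ I ∣ blocks; hence the partition is k-tight iff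
-- m ∸ ∣ I ∣ < k for every maximal independent I, that is, iff m ∸ i < k.
-- Semi-perfection gives m ≥ θ = α, and an α-clique partition exists: assign every
-- vertex to one member of a cover by θ = α cliques; a maximum independent set hits
-- every class, so no class is empty.

module Submission where

open import Defs
open import Data.Bool using (true)
open import Data.Fin using (Fin; zero; suc)
open import Data.Fin.Properties using (any?; suc-injective) renaming (_≟_ to _≟ᶠ_)
open import Data.Fin.Subset
  using (Subset; inside; outside; _∈_; _⊆_; _-_; ∣_∣; ⊤; ⊥; ∁)
open import Data.Fin.Subset.Properties
  using ( _∈?_; ∈⊤; ∣⊤∣≡n; ∣⊥∣≡0; ∣p∣≤n; ∣∁p∣≡n∸∣p∣; x∉p⇒x∈∁p; x∈∁p⇒x∉p
        ; x∈p∧x≢y⇒x∈p-y; x∈p⇒∣p-x∣<∣p∣; out⊆; s⊆s; ⊆-min)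
open import Data.Nat using (ℕ; zero; suc; _∸_; _≤_; _<_; z≤n; s≤s; NonZero)
open import Data.Nat.Properties
  using ( ≤-trans; ≤-<-trans; ≤-reflexive; <-irrefl; ≮⇒≥; ∸-monoˡ-≤
        ; ∸-monoʳ-≤; m∸[m∸n]≡n; module ≤-Reasoning)
open import Data.Product using (Σ; ∃; _×_; _,_; proj₁; proj₂; map₂)
open import Data.Vec using ([]; _∷_; here; there; tabulate)
open import Data.Vec.Properties using ([]=⇒lookup; lookup⇒[]=; lookup∘tabulate)
open import Function using (_∘_)
open import Function.Bundles using (_⇔_; mk⇔)
open import Level using (0ℓ)
open import Relation.Binary.Core using (REL)
open import Relation.Binary.PropositionalEquality
  using (_≡_; _≢_; refl; sym; trans; cong; subst)
open import Relation.Nullary using (¬_; yes; no; does; proof; contradiction; _×-dec_; Reflects; invert)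
open import Relation.Nullary.Decidable using (decidable-stable; dec-true)
open import Relation.Unary using (Pred; Decidable)

-- Pigeonhole principle, by induction on `S`: each element uses up one partner in `T`. With a
-- relation in place of a function, membership of a vertex in a block can be counted in both
-- directions, vertices to blocks and blocks to vertices.
∣∣-mono-relation : ∀ {n m} (R : REL (Fin n) (Fin m) 0ℓ) (S : Subset n) (T : Subset m) →
  (∀ v → v ∈ S → ∃ λ j → j ∈ T × R v j) →
  (∀ {u v j} → u ∈ S → v ∈ S → R u j → R v j → u ≡ v) →
  ∣ S ∣ ≤ ∣ T ∣
∣∣-mono-relation R [] T total inj = z≤n
∣∣-mono-relation R (outside ∷ S) T total inj =
  ∣∣-mono-relation (R ∘ suc) S T (λ v → total (suc v) ∘ there)
    λ u∈S v∈S Ruj Rvj → suc-injective (inj (there u∈S) (there v∈S) Ruj Rvj)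
∣∣-mono-relation R (inside ∷ S) T total inj with total zero here
... | j₀ , j₀∈T , R0j₀ =
  ≤-<-trans (∣∣-mono-relation (R ∘ suc) S (T - j₀) total′
              λ u∈S v∈S Ruj Rvj → suc-injective (inj (there u∈S) (there v∈S) Ruj Rvj))
            (x∈p⇒∣p-x∣<∣p∣ j₀∈T)
  where
  total′ : ∀ v → v ∈ S → ∃ λ j → j ∈ T - j₀ × R (suc v) j
  total′ v v∈S with total (suc v) (there v∈S)
  ... | j , j∈T , Rvj = j , x∈p∧x≢y⇒x∈p-y j∈T j≢j₀ , Rvj
    where
    -- A shared partner would identify `zero` with `suc v`.
    j≢j₀ : j ≢ j₀
    j≢j₀ refl with inj here (there v∈S) R0j₀ Rvj
    ... | ()

subset-of-size : ∀ {n} k (p : Subset n) → k ≤ ∣ p ∣ → ∃ λ q → q ⊆ p × ∣ q ∣ ≡ k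
subset-of-size {n} zero p _ = ⊥ , ⊆-min p , ∣⊥∣≡0 n
subset-of-size (suc k) (outside ∷ p) k<∣p∣ with subset-of-size (suc k) p k<∣p∣
... | q , q⊆p , ∣q∣≡ = outside ∷ q , out⊆ q⊆p , ∣q∣≡
subset-of-size (suc k) (inside ∷ p) (s≤s k≤∣p∣) with subset-of-size k p k≤∣p∣
... | q , q⊆p , ∣q∣≡ = inside ∷ q , s⊆s q⊆p , cong suc ∣q∣≡

module _ {n} {P : Pred (Fin n) 0ℓ} (P? : Decidable P) where

  comprehension : Subset n
  comprehension = tabulate (does ∘ P?)

  ∈-comprehension⁺ : ∀ {x} → P x → x ∈ comprehension
  ∈-comprehension⁺ {x} px =
    lookup⇒[]= x _ (trans (lookup∘tabulate _ x) (dec-true (P? x) px))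

  ∈-comprehension⁻ : ∀ {x} → x ∈ comprehension → P x
  ∈-comprehension⁻ {x} x∈ = invert (subst (Reflects (P x)) does≡true (proof (P? x)))
    where
    does≡true : does (P? x) ≡ true
    does≡true = trans (sym (lookup∘tabulate _ x)) ([]=⇒lookup x∈)

module _ {n} (G : Graph n) where
  open CliquePartition

  independent∩clique : ∀ {I C u v} → Independent G I → Clique G C →
    u ∈ I → v ∈ I → u ∈ C → v ∈ C → u ≡ v
  independent∩clique {u = u} {v} indI clC u∈I v∈I u∈C v∈C =
    decidable-stable (u ≟ᶠ v) λ u≢v → indI u v u∈I v∈I (clC u v u∈C v∈C u≢v)

  θ≤blocks : ∀ {m} → CliquePartition G m → θ G ≤ m
  θ≤blocks {m} 𝒫 = proj₂ (θ-spec G) m (block 𝒫 , clique 𝒫 , covers 𝒫)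

  -- A smallest maximal independent set `I` hits at most `i G` blocks, so it misses at least
  -- `m ∸ i G`; tightness allows at most `k` missed blocks.
  tight⇒μα< : ∀ {m k} → α G ≤ m → (𝒫 : CliquePartition G m) →
    Tight G (suc k) 𝒫 → μα G ≤ k
  tight⇒μα< {m} {k} α≤m 𝒫 tight with proj₁ (i-spec G)
  ... | I , maxI , ∣I∣≡i = begin
    α G ∸ i G      ≤⟨ ∸-monoˡ-≤ (i G) α≤m ⟩
    m ∸ i G        ≡⟨ cong (m ∸_) ∣I∣≡i ⟨
    m ∸ ∣ I ∣      ≤⟨ ∸-monoʳ-≤ m ∣hit∣≤∣I∣ ⟩
    m ∸ ∣ hit ∣    ≡⟨ ∣∁p∣≡n∸∣p∣ hit ⟨
    ∣ ∁ hit ∣      ≤⟨ ≮⇒≥ few-missed ⟩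
    k              ∎
    where
    open ≤-Reasoning

    Hit : Pred (Fin m) 0ℓ
    Hit j = ∃ λ v → v ∈ I × v ∈ block 𝒫 j

    hit? : Decidable Hit
    hit? j = any? λ v → v ∈? I ×-dec v ∈? block 𝒫 j

    hit : Subset m
    hit = comprehension hit?

    ∣hit∣≤∣I∣ : ∣ hit ∣ ≤ ∣ I ∣
    -- Blocks are sent to vertices here: by disjointness no vertex of `I` serves two blocks.
    ∣hit∣≤∣I∣ = ∣∣-mono-relation (λ j v → v ∈ block 𝒫 j) hit I
      (λ _ → ∈-comprehension⁻ hit?)
      (λ {j} {l} {v} _ _ v∈j v∈l →
        decidable-stable (j ≟ᶠ l) λ j≢l → disjoint 𝒫 j l j≢l v v∈j v∈l)

    few-missed : ¬ k < ∣ ∁ hit ∣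
    -- Tightness speaks of exactly `suc k` blocks, so the set of missed blocks is first trimmed to
    -- that size.
    few-missed k<∣missed∣ with subset-of-size (suc k) (∁ hit) k<∣missed∣
    ... | K , K⊆missed , ∣K∣≡ with tight K ∣K∣≡ I maxI
    ... | v , v∈I , j , j∈K , v∈j =
      x∈∁p⇒x∉p (K⊆missed j∈K) (∈-comprehension⁺ hit? (v , v∈I , v∈j))

  -- If `I` avoided all blocks in `K`, it would live in the other `α G ∸ suc k` cliques, with at
  -- most one vertex in each, and the gap would be at least `suc k`.
  μα<⇒tight : ∀ {k} → μα G ≤ k → (𝒫 : αCliquePartition G) → Tight G (suc k) 𝒫
  μα<⇒tight {k} μ≤k 𝒫 K ∣K∣≡ I maxI
    with any? (λ v → v ∈? I ×-dec any? λ j → j ∈? K ×-dec v ∈? block 𝒫 j)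
  ... | yes meets = meets
  ... | no misses = contradiction k<k (<-irrefl refl)
    where
    open ≤-Reasoning

    ∣I∣≤∣∁K∣ : ∣ I ∣ ≤ ∣ ∁ K ∣
    ∣I∣≤∣∁K∣ = ∣∣-mono-relation (λ v j → v ∈ block 𝒫 j) I (∁ K)
      (λ v v∈I → let j , v∈j = covers 𝒫 v in
        j , x∉p⇒x∈∁p (λ j∈K → misses (v , v∈I , j , j∈K , v∈j)) , v∈j)
      (λ {j = j} → independent∩clique (proj₁ maxI) (clique 𝒫 j))

    i≤α∸∣K∣ : i G ≤ α G ∸ ∣ K ∣
    i≤α∸∣K∣ = begin
      i G            ≤⟨ proj₂ (i-spec G) _ (I , maxI , refl) ⟩
      ∣ I ∣          ≤⟨ ∣I∣≤∣∁K∣ ⟩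
      ∣ ∁ K ∣        ≡⟨ ∣∁p∣≡n∸∣p∣ K ⟩
      α G ∸ ∣ K ∣    ∎

    k<k : suc k ≤ k
    k<k = begin
      suc k                    ≡⟨ ∣K∣≡ ⟨
      -- The subtraction is exact, since `K` is a subset of `Fin (α G)`.
      ∣ K ∣                    ≡⟨ m∸[m∸n]≡n (∣p∣≤n K) ⟨
      α G ∸ (α G ∸ ∣ K ∣)      ≤⟨ ∸-monoʳ-≤ (α G) i≤α∸∣K∣ ⟩
      α G ∸ i G                ≤⟨ μ≤k ⟩
      k                        ∎

  -- The classes are the fibres of the map sending a vertex to the member that `cov` picks for it,
  -- hence disjoint. The bound `m ≤ α G` serves to show them nonempty.
  cover⇒partition : ∀ {m} → m ≤ α G → CliqueCoverOfSize G m → CliquePartition G m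
  cover⇒partition {m} m≤α (F , clF , cov) = record
    { block    = class
    ; nonempty = λ j → map₂ (∈-comprehension⁺ (in-class? j)) (inhabited j)
    ; clique   = λ j u v u∈ v∈ → clF j u v (class⊆F u∈) (class⊆F v∈)
    ; disjoint = λ j l j≢l v v∈j v∈l → j≢l
        (trans (sym (∈-comprehension⁻ (in-class? j) v∈j)) (∈-comprehension⁻ (in-class? l) v∈l))
    ; covers   = λ v → index v , ∈-comprehension⁺ (in-class? (index v)) refl
    }
    where
    index : Fin n → Fin m
    index v = proj₁ (cov v)

    in-class? : ∀ j → Decidable λ v → index v ≡ j
    in-class? j v = index v ≟ᶠ j

    class : Fin m → Subset n
    class j = comprehension (in-class? j)

    index⇒∈F : ∀ {v j} → index v ≡ j → v ∈ F j
    index⇒∈F {v} refl = proj₂ (cov v)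

    class⊆F : ∀ {j} → class j ⊆ F j
    class⊆F {j} = index⇒∈F ∘ ∈-comprehension⁻ (in-class? j)

    inhabited : ∀ j → ∃ λ v → index v ≡ j
    inhabited j with any? (in-class? j) | proj₁ (α-spec G)
    ... | yes found | _ = found
    ... | no  empty | S , indS , ∣S∣≡α = contradiction m<m (<-irrefl refl)
      where
      open ≤-Reasoning
      m<m : m < m
      m<m = begin-strict
        m            ≤⟨ m≤α ⟩
        α G          ≡⟨ ∣S∣≡α ⟨
        -- With class `j` empty, the maximum independent set `S` injects into the other indices.
        ∣ S ∣        ≤⟨ ∣∣-mono-relation (λ v l → index v ≡ l) S (⊤ - j)
                          (λ v _ → index v , x∈p∧x≢y⇒x∈p-y ∈⊤ (λ e → empty (v , e)) , refl)
                          (λ {j = l} u∈S v∈S eu ev →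
                            independent∩clique indS (clF l) u∈S v∈S (index⇒∈F eu) (index⇒∈F ev)) ⟩
        ∣ ⊤ - j ∣    <⟨ x∈p⇒∣p-x∣<∣p∣ (∈⊤ {x = j}) ⟩
        ∣ ⊤ {m} ∣    ≡⟨ ∣⊤∣≡n m ⟩
        m            ∎

  semiPerfect⇒αCliquePartition : SemiPerfect G → αCliquePartition G
  semiPerfect⇒αCliquePartition α≡θ = subst (CliquePartition G) (sym α≡θ)
    (cover⇒partition (≤-reflexive (sym α≡θ)) (proj₁ (θ-spec G)))

mainTheorem4 : ∀ {n : ℕ} (G : Graph n) → SemiPerfect G → ∀ (k : ℕ) .{{_ : NonZero k}} →
    let a = ∃ λ (m : ℕ) → Σ (CliquePartition G m) λ 𝒫 → Tight G k 𝒫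
        b = Σ (αCliquePartition G) λ 𝒫 → Tight G k 𝒫
        c = ∀ (𝒫 : αCliquePartition G) → Tight G k 𝒫
        d = μα G ≤ k ∸ 1
    in (a ⇔ b) × (b ⇔ c) × (c ⇔ d)
mainTheorem4 G α≡θ (suc k) =
  -- All implications are paths round the cycle a, d, c, b, a. Semi-perfection enters in `a⇒d`, as
  -- `α G ≤ m`, and in `c⇒b`, where it supplies a partition to which (c) applies.
  mk⇔ (c⇒b ∘ d⇒c ∘ a⇒d) b⇒a , mk⇔ (d⇒c ∘ a⇒d ∘ b⇒a) c⇒b , mk⇔ (a⇒d ∘ b⇒a ∘ c⇒b) d⇒c
  where
  a⇒d : (∃ λ m → Σ (CliquePartition G m) λ 𝒫 → Tight G (suc k) 𝒫) → μα G ≤ k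
  a⇒d (m , 𝒫 , tight) =
    tight⇒μα< G (≤-trans (≤-reflexive α≡θ) (θ≤blocks G 𝒫)) 𝒫 tight

  d⇒c : μα G ≤ k → ∀ 𝒫 → Tight G (suc k) 𝒫
  d⇒c = μα<⇒tight G

  c⇒b : (∀ 𝒫 → Tight G (suc k) 𝒫) → Σ (αCliquePartition G) λ 𝒫 → Tight G (suc k) 𝒫
  c⇒b tight = let 𝒫 = semiPerfect⇒αCliquePartition G α≡θ in 𝒫 , tight 𝒫

  b⇒a : (Σ (αCliquePartition G) λ 𝒫 → Tight G (suc k) 𝒫) →
        ∃ λ m → Σ (CliquePartition G m) λ 𝒫 → Tight G (suc k) 𝒫
  b⇒a = α G ,_
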